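{- For integers $\alpha,\beta,\gamma,\delta$ and $n\ge 0$ let $$G_{\alpha,\beta,\gamma,\delta}(n):=\det_{0\leq i,j\le n-1}\left(2^{i+\beta}\binom{i+4j+\gamma}{4j+\alpha}+\binom{ -i+4j+\delta}{4j+\alpha}\right).$$ For all integers $n\geq2$ the following relations hold: \begin{align*} G_{0, 1, -2, -4}(n) &= 3 \, G_{4, 2, 3, -1}(n-1) = 3 \, G_{8, 3, 8, 2}(n-2),\\ G_{1, 1, 0, -2}(n) &= -2 \, G_{5, 2, 5, 1}(n-1),\\ G_{3, 3, 2, -4}(n) &= -20 \, G_{7, 4, 7, -1}(n-1). \end{align*}
   Context: For an integer $m$ (possibly negative) and an integer $p\ge 0$, $\binom{m}{p}=\frac{m(m-1)\cdots(m-p+1)}{p!}$; for $p<0$, $\binom{m}{p}=0$. The determinant of the empty ($0\times 0$) matrix is $1$. -}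

module Defs where

open import Data.Fin using (Fin; zero; suc; toℕ; punchIn)
open import Data.Integer as ℤ using (ℤ; +_; -[1+_])
open import Data.Nat using (ℕ; zero; suc; _!)
open import Data.Nat.Properties using (_!≢0)
open import Data.Rational
  using (ℚ; 1ℚ; ½; _+_; _*_; -_; _/_; +-0-rawMonoid; +-*-rawSemiring)
open import Algebra.Definitions.RawMonoid +-0-rawMonoid using (sum)
open import Algebra.Definitions.RawSemiring +-*-rawSemiring using (_^_)

fallingFactorial : ℤ → ℕ → ℤ
fallingFactorial m zero    = + 1
fallingFactorial m (suc p) = fallingFactorial m p ℤ.* (m ℤ.- + p)

binom : ℤ → ℤ → ℚ
binom m (+ p)    = (fallingFactorial m p / p !) {{p !≢0}}
binom m -[1+ _ ] = + 0 / 1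

2^_ : ℤ → ℚ
2^ (+ k)    = (+ 2 / 1) ^ k
2^ -[1+ k ] = ½ ^ suc k

Matrix : ℕ → Set
Matrix n = Fin n → Fin n → ℚ

minor : ∀ {n} → Fin (suc n) → Fin (suc n) → Matrix (suc n) → Matrix n
minor i j A k l = A (punchIn i k) (punchIn j l)

-- Laplace expansion along the first column.
det : ∀ {n} → Matrix n → ℚ
det {zero}  A = 1ℚ
det {suc n} A =
  sum (λ i → (- 1ℚ) ^ toℕ i * A i zero * det (minor i zero A))

-- Rational-valued, since β may be negative.
entry : (α β γ δ i j : ℤ) → ℚ
entry α β γ δ i j =
    2^ (i ℤ.+ β) * binom (i ℤ.+ + 4 ℤ.* j ℤ.+ γ) (+ 4 ℤ.* j ℤ.+ α)
  + binom (ℤ.- i ℤ.+ + 4 ℤ.* j ℤ.+ δ) (+ 4 ℤ.* j ℤ.+ α)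

G : (α β γ δ : ℤ) → ℕ → ℚ
G α β γ δ n = det {n} (λ i j → entry α β γ δ (+ toℕ i) (+ toℕ j))

{-# OPTIONS --safe #-}
-- In each of the four determinants on the left-hand sides of a relation, the first row vanishes
-- apart from its leading entry, because binom x y = 0 for 0 ≤ x < y. Deleting the first row and
-- column replaces (i , j) by (i + 1 , j + 1), which turns G α β γ δ into
-- G (α + 4) (β + 1) (γ + 5) (δ + 3).
module Submission where

open import Defs
import Algebra.Definitions.RawMonoid
import Algebra.Definitions.RawSemiring
import Algebra.Properties.Monoid.Sum
open import Data.Fin using (Fin; zero; suc; toℕ; punchIn)
open import Data.Integer using (+_; -_)
import Data.Integer as ℤ
import Data.Integer.Properties as ℤ
open import Data.Integer.Tactic.RingSolver using (solve-∀)
open import Data.Nat using (ℕ; zero; suc; _≤_; _∸_; _!; z≤n; s≤s)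
import Data.Nat as ℕ
import Data.Nat.Properties as ℕ
open import Data.Product using (_×_; _,_)
open import Data.Rational using (ℚ; 0ℚ; 1ℚ; _+_; _*_; _/_)
import Data.Rational as ℚ
import Data.Rational.Properties as ℚ
open import Data.Sum using (inj₁; inj₂)
open import Relation.Binary.PropositionalEquality
  using (_≡_; refl; trans; cong; cong₂; module ≡-Reasoning)
open import Relation.Nullary.Decidable using (True; toWitness)

open Algebra.Definitions.RawMonoid ℚ.+-0-rawMonoid using (sum)
open Algebra.Definitions.RawSemiring ℚ.+-*-rawSemiring using (_^_)
open Algebra.Properties.Monoid.Sum ℚ.+-0-monoid using (sum-cong-≗; sum-replicate-zero)

sum-zero : ∀ {n} (f : Fin n → ℚ) → (∀ i → f i ≡ 0ℚ) → sum f ≡ 0ℚ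
sum-zero {n} f f≡0 = trans (sum-cong-≗ f≡0) (sum-replicate-zero n)

det-cong : ∀ {n} {A B : Matrix n} → (∀ i j → A i j ≡ B i j) → det A ≡ det B
det-cong {zero}  A≡B = refl
det-cong {suc n} A≡B = sum-cong-≗ λ i →
  cong₂ _*_ (cong ((ℚ.- 1ℚ) ^ toℕ i *_) (A≡B i zero))
            (det-cong λ k l → A≡B (punchIn i k) (suc l))

-- Mutually recursive with `det-sparse-row`: a zero row is sparse, and its leading entry kills the
-- one remaining term. The size drops when the sparse case passes to minors.
det-zero-row : ∀ {n} (A : Matrix (suc n)) → (∀ j → A zero j ≡ 0ℚ) → det A ≡ 0ℚ

-- `det` expands along the first column, not the first row. Every term after the first still
-- vanishes, since deleting a later row leaves a minor whose top row is zero.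
det-sparse-row : ∀ {n} (A : Matrix (suc n)) → (∀ j → A zero (suc j) ≡ 0ℚ) →
                 det A ≡ A zero zero * det (minor zero zero A)
det-sparse-row {n} A row≡0 = begin
  1ℚ * A zero zero * det (minor zero zero A) + sum (λ i → coeff i * det (minor (suc i) zero A))
    ≡⟨ cong₂ _+_ (cong (_* det (minor zero zero A)) (ℚ.*-identityˡ (A zero zero)))
                 (sum-zero _ λ i → trans (cong (coeff i *_) (minor≡0 A row≡0 i))
                                         (ℚ.*-zeroʳ (coeff i))) ⟩
  A zero zero * det (minor zero zero A) + 0ℚ
    ≡⟨ ℚ.+-identityʳ _ ⟩
  A zero zero * det (minor zero zero A) ∎
  where
  open ≡-Reasoning
  coeff : Fin n → ℚ
  coeff i = (ℚ.- 1ℚ) ^ toℕ (suc i) * A (suc i) zero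
  minor≡0 : ∀ {n} (A : Matrix (suc n)) → (∀ j → A zero (suc j) ≡ 0ℚ) →
            ∀ i → det (minor (suc i) zero A) ≡ 0ℚ
  -- An index `i` exists only for positive size, so the minor does have a top row; it is that of `A`
  -- without its leading entry.
  minor≡0 {suc n} A row≡0 i = det-zero-row (minor (suc i) zero A) row≡0

det-zero-row A row≡0 =
  trans (det-sparse-row A λ j → row≡0 (suc j))
        (trans (cong (_* det (minor zero zero A)) (row≡0 zero))
               (ℚ.*-zeroˡ (det (minor zero zero A))))

-- The product contains the factor `m - m`, either as its last factor or in the shorter product
-- before it.
fallingFactorial-zero : ∀ {m p} → m ℕ.< p → fallingFactorial (+ m) p ≡ + 0
fallingFactorial-zero {m} {suc p} (s≤s m≤p) with ℕ.m≤n⇒m<n∨m≡n m≤p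
... | inj₁ m<p rewrite fallingFactorial-zero m<p = ℤ.*-zeroˡ (+ m ℤ.- + p)
... | inj₂ refl rewrite ℤ.+-inverseʳ (+ m) = ℤ.*-zeroʳ (fallingFactorial (+ m) m)

binom-zero : ∀ {x y} → + 0 ℤ.≤ x → x ℤ.< y → binom x y ≡ 0ℚ
binom-zero {+ m} {+ p} _ (ℤ.+<+ m<p) rewrite fallingFactorial-zero m<p =
  ℚ.0/n≡0 (p !) {{p ℕ.!≢0}}

-- From the second column on, `4 * suc j` is at least 4, so a `γ` as low as -4 still gives a
-- nonnegative upper argument.
binom-row-zero : ∀ {α γ} → - (+ 4) ℤ.≤ γ → γ ℤ.< α → ∀ j →
                 binom (+ 0 ℤ.+ + 4 ℤ.* + suc j ℤ.+ γ) (+ 4 ℤ.* + suc j ℤ.+ α) ≡ 0ℚ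
binom-row-zero {α} {γ} γ≥-4 γ<α j
  rewrite ℤ.+-identityˡ (+ 4 ℤ.* + suc j) =
  binom-zero (ℤ.+-mono-≤ {+ 4} {+ 4 ℤ.* + suc j} 4≤4j γ≥-4) (ℤ.+-monoʳ-< (+ 4 ℤ.* + suc j) γ<α)
  where
  4≤4j : + 4 ℤ.≤ + 4 ℤ.* + suc j
  4≤4j = ℤ.*-monoˡ-≤-nonNeg (+ 4) (ℤ.+≤+ (s≤s (z≤n {j})))

entry-row-zero : ∀ {α γ δ} β → - (+ 4) ℤ.≤ γ → γ ℤ.< α → - (+ 4) ℤ.≤ δ → δ ℤ.< α →
                 ∀ j → entry α β γ δ (+ 0) (+ suc j) ≡ 0ℚ
entry-row-zero β γ≥-4 γ<α δ≥-4 δ<α j =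
  trans (cong₂ _+_ (cong (2^ (+ 0 ℤ.+ β) *_) (binom-row-zero γ≥-4 γ<α j))
                   (binom-row-zero δ≥-4 δ<α j))
        (trans (ℚ.+-identityʳ _) (ℚ.*-zeroʳ (2^ (+ 0 ℤ.+ β))))

-- Raising `j` adds 4 to every binomial argument; raising `i` changes the upper ones by 1 and -1,
-- whence 5 and 3.
entry-shift : ∀ α β γ δ i j →
  entry α β γ δ (+ 1 ℤ.+ i) (+ 1 ℤ.+ j) ≡
  entry (α ℤ.+ + 4) (β ℤ.+ + 1) (γ ℤ.+ + 5) (δ ℤ.+ + 3) i j
entry-shift α β γ δ i j =
  cong₂ _+_ (cong₂ _*_ (cong 2^_ (exponent i β)) (cong₂ binom (upper₁ i j γ) (lower j α)))
            (cong₂ binom (upper₂ i j δ) (lower j α))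
  where
  exponent : ∀ i β → + 1 ℤ.+ i ℤ.+ β ≡ i ℤ.+ (β ℤ.+ + 1)
  exponent = solve-∀
  lower : ∀ j α → + 4 ℤ.* (+ 1 ℤ.+ j) ℤ.+ α ≡ + 4 ℤ.* j ℤ.+ (α ℤ.+ + 4)
  lower = solve-∀
  upper₁ : ∀ i j γ → + 1 ℤ.+ i ℤ.+ + 4 ℤ.* (+ 1 ℤ.+ j) ℤ.+ γ ≡ i ℤ.+ + 4 ℤ.* j ℤ.+ (γ ℤ.+ + 5)
  upper₁ = solve-∀
  upper₂ : ∀ i j δ → - (+ 1 ℤ.+ i) ℤ.+ + 4 ℤ.* (+ 1 ℤ.+ j) ℤ.+ δ ≡ - i ℤ.+ + 4 ℤ.* j ℤ.+ (δ ℤ.+ + 3)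
  upper₂ = solve-∀

-- The bounds are stated through `True`, so that for concrete parameters they are decided by
-- evaluation and filled in implicitly.
G-suc : ∀ α β γ δ {_ : True (- (+ 4) ℤ.≤? γ)} {_ : True (γ ℤ.<? α)}
                  {_ : True (- (+ 4) ℤ.≤? δ)} {_ : True (δ ℤ.<? α)} n →
        G α β γ δ (suc n) ≡
        entry α β γ δ (+ 0) (+ 0) * G (α ℤ.+ + 4) (β ℤ.+ + 1) (γ ℤ.+ + 5) (δ ℤ.+ + 3) n
G-suc α β γ δ {γ≥-4} {γ<α} {δ≥-4} {δ<α} n =
  trans (det-sparse-row {n} (λ i j → entry α β γ δ (+ toℕ i) (+ toℕ j)) λ j →
           entry-row-zero β (toWitness γ≥-4) (toWitness γ<α) (toWitness δ≥-4) (toWitness δ<α)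
                          (toℕ j))
        (cong (entry α β γ δ (+ 0) (+ 0) *_)
              -- `punchIn zero` is `suc`, and `+ 1 ℤ.+ + k` computes to `+ suc k`, so the entries of
              -- the minor already have the shifted form.
              (det-cong {n} λ i j → entry-shift α β γ δ (+ toℕ i) (+ toℕ j)))

proposition22 : ∀ (n : ℕ) → 2 ≤ n →
    ( G (+ 0) (+ 1) (- (+ 2)) (- (+ 4)) n ≡ (+ 3 / 1) * G (+ 4) (+ 2) (+ 3) (- (+ 1)) (n ∸ 1)
    × (+ 3 / 1) * G (+ 4) (+ 2) (+ 3) (- (+ 1)) (n ∸ 1) ≡ (+ 3 / 1) * G (+ 8) (+ 3) (+ 8) (+ 2) (n ∸ 2) )
    × ( G (+ 1) (+ 1) (+ 0) (- (+ 2)) n ≡ (- (+ 2) / 1) * G (+ 5) (+ 2) (+ 5) (+ 1) (n ∸ 1) )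
    × ( G (+ 3) (+ 3) (+ 2) (- (+ 4)) n ≡ (- (+ 20) / 1) * G (+ 7) (+ 4) (+ 7) (- (+ 1)) (n ∸ 1) )
proposition22 (suc (suc n)) (s≤s (s≤s _)) =
    -- The constants are the leading entries, found by evaluation: 2 + 1 = 3, then 0 + 1 = 1
    -- (removed by `*-identityˡ`), 0 - 2 = -2 and 0 - 20 = -20.
    ( G-suc (+ 0) (+ 1) (- (+ 2)) (- (+ 4)) (suc n)
    , cong ((+ 3 / 1) *_)
        (trans (G-suc (+ 4) (+ 2) (+ 3) (- (+ 1)) n)
               (ℚ.*-identityˡ (G (+ 8) (+ 3) (+ 8) (+ 2) n))) )
  , G-suc (+ 1) (+ 1) (+ 0) (- (+ 2)) (suc n)
  , G-suc (+ 3) (+ 3) (+ 2) (- (+ 4)) (suc n)
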